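{- If $T$ is a tree of maximum degree at most $3$, then $\gamma_e(T)\geq \frac{1}{6}(n(T)+2)$, where $n(T)$ is the order of $T$.
   Context: All graphs are finite, simple and undirected. For a graph $G$ and $S\subseteq V(G)$, and vertices $u,v$ with $u\in S$ or $v\in S$, let $\mathrm{dist}_{(G,S)}(u,v)$ be the minimum number of edges of a path $P$ in $G$ between $u$ and $v$ such that $S$ contains exactly one endvertex of $P$ and no internal vertex of $P$ (and $\infty$ if no such path exists; in particular $\mathrm{dist}_{(G,S)}(u,u)=0$ for $u\in S$). For a vertex $u$, let $w_{(G,S)}(u)=\sum_{v\in S}\left(\frac{1}{2}\right)^{\mathrm{dist}_{(G,S)}(u,v)-1}$ with $(1/2)^\infty=0$. The set $S$ is an exponential dominating set of $G$ if $w_{(G,S)}(u)\geq 1$ for every vertex $u$ of $G$. The exponential domination number $\gamma_e(G)$ is the minimum cardinality of an exponential dominating set of $G$. -}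

module Defs where

open import Data.Nat using (ℕ; zero; suc; _+_; _*_; _<_; _≤_)
open import Data.Bool using (Bool; true; false)
open import Data.Fin using (Fin; zero; suc; toℕ; inject₁; fromℕ)
open import Data.Fin.Subset using (Subset; _∈_; _∉_; ∣_∣)
open import Data.Vec using (Vec; lookup; tabulate)
open import Data.Maybe using (Maybe; just; nothing)
open import Data.Product using (Σ; ∃; _×_; _,_)
open import Data.Sum using (_⊎_)
open import Relation.Binary.PropositionalEquality using (_≡_)
open import Relation.Nullary using (¬_)
import Data.Rational as ℚ
open ℚ using (ℚ; ½; 1ℚ; 0ℚ)

record Graph (n : ℕ) : Set where
  field
    adj    : Fin n → Fin n → Bool
    sym    : ∀ u v → adj u v ≡ adj v u
    irrefl : ∀ u → adj u u ≡ false
open Graph public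

module _ {n : ℕ} (G : Graph n) where

  degree : Fin n → ℕ
  degree u = ∣ tabulate (adj G u) ∣

  MaxDegreeAtMost : ℕ → Set
  MaxDegreeAtMost d = ∀ u → degree u ≤ d

  IsPath : (k : ℕ) → Vec (Fin n) (suc k) → Set
  IsPath k p =
    (∀ (i : Fin k) → adj G (lookup p (inject₁ i)) (lookup p (suc i)) ≡ true) ×
    (∀ (i j : Fin (suc k)) → lookup p i ≡ lookup p j → i ≡ j)

  start end : {k : ℕ} → Vec (Fin n) (suc k) → Fin n
  start p = lookup p zero
  end {k} p = lookup p (fromℕ k)

  PathBetween : Fin n → Fin n → (k : ℕ) → Vec (Fin n) (suc k) → Set
  PathBetween u v k p = IsPath k p × start p ≡ u × end p ≡ v

  Connected : Set
  Connected = ∀ u v → Σ ℕ λ k → Σ (Vec (Fin n) (suc k)) λ p → PathBetween u v k p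

  Acyclic : Set
  Acyclic = ∀ (k : ℕ) (p : Vec (Fin n) (suc (suc (suc k)))) →
            IsPath (suc (suc k)) p → ¬ (adj G (end p) (start p) ≡ true)

  IsTree : Set
  IsTree = (1 ≤ n) × Connected × Acyclic

  module _ (S : Subset n) where

    SPath : (k : ℕ) → Vec (Fin n) (suc k) → Set
    SPath k p =
      IsPath k p ×
      (((start p ∈ S) × (end p ∉ S)) ⊎ ((start p ∉ S) × (end p ∈ S))
         ⊎ ((start p ≡ end p) × (start p ∈ S))) ×
      (∀ (i : Fin (suc k)) → 0 < toℕ i → toℕ i < k → lookup p i ∉ S)

    SPathBetween : Fin n → Fin n → ℕ → Set
    SPathBetween u v k =
      Σ (Vec (Fin n) (suc k)) λ p → SPath k p × start p ≡ u × end p ≡ v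

    -- IsDist u v (just d) : dist_(G,S)(u,v) = d ;  IsDist u v nothing : = ∞
    IsDist : Fin n → Fin n → Maybe ℕ → Set
    IsDist u v (just d) = SPathBetween u v d × (∀ k → k < d → ¬ SPathBetween u v k)
    IsDist u v nothing  = ∀ k → ¬ SPathBetween u v k

    -- (1/2)^(d-1), with (1/2)^∞ = 0
    halfPow : ℕ → ℚ
    halfPow zero    = 1ℚ
    halfPow (suc k) = ½ ℚ.* halfPow k

    weightTerm : Maybe ℕ → ℚ
    weightTerm nothing        = 0ℚ
    weightTerm (just zero)    = 1ℚ ℚ.+ 1ℚ
    weightTerm (just (suc k)) = halfPow k

    sumS : (Fin n → ℚ) → ℚ
    sumS f = go n (λ i → i)
      where
        go : (m : ℕ) → (Fin m → Fin n) → ℚ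
        go zero    ι = 0ℚ
        go (suc m) ι with lookup S (ι zero)
        ... | true  = f (ι zero) ℚ.+ go m (λ i → ι (suc i))
        ... | false = go m (λ i → ι (suc i))

    -- S is an exponential dominating set: for every vertex u, w_(G,S)(u) ≥ 1,
    -- where δ is the distance function v ↦ dist_(G,S)(u,v) (which exists and
    -- is uniquely determined by IsDist).
    IsExpDominating : Set
    IsExpDominating =
      ∀ (u : Fin n) (δ : Fin n → Maybe ℕ) →
        (∀ v → v ∈ S → IsDist u v (δ v)) →
        1ℚ ℚ.≤ sumS (λ v → weightTerm (δ v))

{-# OPTIONS --safe #-}
-- For u ∉ S let d(u) be the number of neighbours of u outside S, and give u the capacity
-- 3 - d(u) ≥ 0.  These capacities are the equilibrium measure of the kernel 2^(-dist) on each
-- component of T - S: for v ∈ S the capacity-weighted sum of (1/2)^(dist(u,v) - 1) over u ∉ S is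
-- at most 3 d(v).  Summing over v ∈ S and using w(u) ≥ 1, the total capacity is at most 3 e, where
-- e is the number of edges between S and its complement.  Together with |E(T)| ≤ n - 1 (leaf
-- deletion) and the bound 3 |S| on the degree sum over S, this linear inequality gives
-- n + 2 ≤ 6 |S|.
module Submission where

open import Defs hiding (sym)
open import Data.Nat using (ℕ)
open import Data.Fin.Subset using (Subset; ∣_∣)

-- Finite sums of rationals, indicators, and natural numbers inside ℚ.

module RationalSums where

  import Algebra.Properties.Semiring.Sum as SemiringSum
  open import Algebra.Bundles using (CommutativeRing)
  open import Data.Bool using (Bool; true; false; not)
  open import Data.Fin using (Fin; zero; suc; _≟_)
  import Data.Integer as ℤ
  import Data.Nat as ℕ
  import Data.Nat.Properties as ℕ
  open import Data.Rational
    using (ℚ; 0ℚ; 1ℚ; _+_; _*_; _-_; -_; _/_; _≤_; _<_; nonNegative)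
  open import Data.Rational.Properties hiding (_≟_)
  open import Data.Rational.Solver using (module +-*-Solver)
  open import Data.Vec using (lookup; tabulate)
  open import Data.Vec.Properties using (tabulate∘lookup)
  open import Relation.Binary.PropositionalEquality
    using (_≡_; refl; sym; trans; cong; cong₂; subst; subst₂; module ≡-Reasoning)
  open import Relation.Nullary using (does)
  open +-*-Solver using (solve; _:=_; _:+_; _:*_; _:-_; con)

  open SemiringSum (CommutativeRing.semiring +-*-commutativeRing) public
    using (sum; sum-cong-≗; sum-remove; ∑-distrib-+; ∑-comm; *-distribˡ-sum; *-distribʳ-sum)

  2ℚ 3ℚ 6ℚ : ℚ
  2ℚ = ℤ.+ 2 / 1
  3ℚ = ℤ.+ 3 / 1
  6ℚ = ℤ.+ 6 / 1

  0≤1 : 0ℚ ≤ 1ℚ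
  0≤1 = nonNegative⁻¹ 1ℚ

  +-nonNeg : ∀ {x y} → 0ℚ ≤ x → 0ℚ ≤ y → 0ℚ ≤ x + y
  +-nonNeg = +-mono-≤

  *-monoˡ-≤ : ∀ {z x y} → 0ℚ ≤ z → x ≤ y → z * x ≤ z * y
  *-monoˡ-≤ {z} 0≤z = *-monoˡ-≤-nonNeg z {{nonNegative 0≤z}}

  *-nonNeg : ∀ {x y} → 0ℚ ≤ x → 0ℚ ≤ y → 0ℚ ≤ x * y
  *-nonNeg {x} {y} 0≤x 0≤y = subst (_≤ x * y) (*-zeroʳ x) (*-monoˡ-≤ 0≤x 0≤y)

  ≤⇒0≤- : ∀ {x y} → x ≤ y → 0ℚ ≤ y - x
  ≤⇒0≤- {x} {y} x≤y = subst (_≤ y - x) (+-inverseʳ x) (+-monoˡ-≤ (- x) x≤y)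

  -- The difference enters through an equation, so that a linear inequality follows once the ring
  -- solver has rewritten `y - x` as a visibly nonnegative `z`.
  0≤-⇒≤ : ∀ {x y z} → y - x ≡ z → 0ℚ ≤ z → x ≤ y
  0≤-⇒≤ {x} {y} refl 0≤y-x =
    subst₂ _≤_ (+-identityˡ x) (solve 2 (λ a b → (b :- a) :+ a := b) refl x y) (+-monoˡ-≤ x 0≤y-x)

  sum-mono-≤ : ∀ {n} {f g : Fin n → ℚ} → (∀ i → f i ≤ g i) → sum f ≤ sum g
  sum-mono-≤ {ℕ.zero}  f≤g = ≤-refl
  sum-mono-≤ {ℕ.suc n} f≤g = +-mono-≤ (f≤g zero) (sum-mono-≤ (λ i → f≤g (suc i)))

  sum-nonNeg : ∀ {n} {f : Fin n → ℚ} → (∀ i → 0ℚ ≤ f i) → 0ℚ ≤ sum f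
  sum-nonNeg {ℕ.zero}  0≤f = ≤-refl
  sum-nonNeg {ℕ.suc n} 0≤f = +-nonNeg (0≤f zero) (sum-nonNeg (λ i → 0≤f (suc i)))

  -- Transposition of a bilinear form: both sides are the double sum of `a i * M i j * b j`. It
  -- serves for the adjacency matrix and for the matrix of weights.
  ∑-bilinear : ∀ {m n} (a : Fin m → ℚ) (M : Fin m → Fin n → ℚ) (b : Fin n → ℚ) →
    sum (λ i → a i * sum (λ j → M i j * b j)) ≡ sum (λ j → b j * sum (λ i → M i j * a i))
  ∑-bilinear a M b = begin
    sum (λ i → a i * sum (λ j → M i j * b j))
      ≡⟨ sum-cong-≗ (λ i → *-distribˡ-sum (a i) (λ j → M i j * b j)) ⟩
    sum (λ i → sum (λ j → a i * (M i j * b j)))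
      ≡⟨ ∑-comm (λ i j → a i * (M i j * b j)) ⟩
    sum (λ j → sum (λ i → a i * (M i j * b j)))
      ≡⟨ sum-cong-≗ (λ j → sum-cong-≗ (λ i →
           solve 3 (λ x y z → x :* (y :* z) := z :* (y :* x)) refl (a i) (M i j) (b j))) ⟩
    sum (λ j → sum (λ i → b j * (M i j * a i)))
      ≡⟨ sum-cong-≗ (λ j → sym (*-distribˡ-sum (b j) (λ i → M i j * a i))) ⟩
    sum (λ j → b j * sum (λ i → M i j * a i)) ∎
    where open ≡-Reasoning

  ∑-linear : ∀ {n} a b (f g : Fin n → ℚ) → sum (λ i → a * f i + b * g i) ≡ a * sum f + b * sum g
  ∑-linear a b f g = trans (∑-distrib-+ (λ i → a * f i) (λ i → b * g i))
    (sym (cong₂ _+_ (*-distribˡ-sum a f) (*-distribˡ-sum b g)))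

  ⟦_⟧ : Bool → ℚ
  ⟦ true ⟧  = 1ℚ
  ⟦ false ⟧ = 0ℚ

  ⟦⟧-nonNeg : ∀ b → 0ℚ ≤ ⟦ b ⟧
  ⟦⟧-nonNeg true  = 0≤1
  ⟦⟧-nonNeg false = ≤-refl

  ⟦⟧-complement : ∀ b → ⟦ b ⟧ + ⟦ not b ⟧ ≡ 1ℚ
  ⟦⟧-complement true  = refl
  ⟦⟧-complement false = refl

  -- An indicator as a factor restricts a sum to a subset; the terms then need comparing only where
  -- the indicator is 1.
  ⟦⟧-*-mono-≤ : ∀ b {x y} → (b ≡ true → x ≤ y) → ⟦ b ⟧ * x ≤ ⟦ b ⟧ * y
  ⟦⟧-*-mono-≤ true  x≤y = *-monoˡ-≤ 0≤1 (x≤y refl)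
  ⟦⟧-*-mono-≤ false {x} {y} _ = ≤-reflexive (trans (*-zeroˡ x) (sym (*-zeroˡ y)))

  sum-zero : ∀ n → sum {n} (λ _ → 0ℚ) ≡ 0ℚ
  sum-zero ℕ.zero    = refl
  sum-zero (ℕ.suc n) = trans (+-identityˡ _) (sum-zero n)

  sum-kronecker : ∀ {n} (i : Fin n) → sum (λ j → ⟦ does (j ≟ i) ⟧) ≡ 1ℚ
  sum-kronecker {ℕ.suc n} zero    = trans (cong (1ℚ +_) (sum-zero n)) (+-identityʳ 1ℚ)
  sum-kronecker {ℕ.suc n} (suc i) = trans (+-identityˡ _) (sum-kronecker i)

  toℚ : ℕ → ℚ
  toℚ ℕ.zero    = 0ℚ
  toℚ (ℕ.suc n) = 1ℚ + toℚ n

  toℚ-+ : ∀ m n → toℚ (m ℕ.+ n) ≡ toℚ m + toℚ n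
  toℚ-+ ℕ.zero    n = sym (+-identityˡ _)
  toℚ-+ (ℕ.suc m) n = trans (cong (1ℚ +_) (toℚ-+ m n)) (sym (+-assoc 1ℚ (toℚ m) (toℚ n)))

  toℚ-nonNeg : ∀ n → 0ℚ ≤ toℚ n
  toℚ-nonNeg ℕ.zero    = ≤-refl
  toℚ-nonNeg (ℕ.suc n) = +-nonNeg 0≤1 (toℚ-nonNeg n)

  toℚ-mono-≤ : ∀ {m n} → m ℕ.≤ n → toℚ m ≤ toℚ n
  toℚ-mono-≤ {n = n} ℕ.z≤n = toℚ-nonNeg n
  toℚ-mono-≤ (ℕ.s≤s m≤n)   = +-monoʳ-≤ 1ℚ (toℚ-mono-≤ m≤n)

  toℚ-<-suc : ∀ n → toℚ n < toℚ (ℕ.suc n)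
  toℚ-<-suc n = subst (_< 1ℚ + toℚ n) (+-identityˡ (toℚ n)) (+-monoˡ-< (toℚ n) (positive⁻¹ 1ℚ))

  toℚ-cancel-≤ : ∀ {m n} → toℚ m ≤ toℚ n → m ℕ.≤ n
  toℚ-cancel-≤ {m} {n} m≤n = ℕ.≮⇒≥ λ n<m →
    <-irrefl refl (<-≤-trans (toℚ-<-suc n) (≤-trans (toℚ-mono-≤ n<m) m≤n))

  toℚ-6* : ∀ n → toℚ (6 ℕ.* n) ≡ 6ℚ * toℚ n
  toℚ-6* n = begin
    toℚ (6 ℕ.* n)
      ≡⟨ +ₙ (5 ℕ.* n) (+ₙ (4 ℕ.* n) (+ₙ (3 ℕ.* n) (+ₙ (2 ℕ.* n) (+ₙ (1 ℕ.* n) (+ₙ 0 refl))))) ⟩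
    x + (x + (x + (x + (x + (x + 0ℚ)))))
      ≡⟨ solve 1 (λ y → y :+ (y :+ (y :+ (y :+ (y :+ (y :+ con 0ℚ))))) := con 6ℚ :* y) refl x ⟩
    6ℚ * x ∎
    where
    open ≡-Reasoning
    x = toℚ n
    +ₙ : ∀ m {y} → toℚ m ≡ y → toℚ (n ℕ.+ m) ≡ x + y
    +ₙ m eq = trans (toℚ-+ n m) (cong (x +_) eq)

  toℚ-∣tabulate∣ : ∀ {n} (g : Fin n → Bool) → toℚ ∣ tabulate g ∣ ≡ sum (λ i → ⟦ g i ⟧)
  toℚ-∣tabulate∣ {ℕ.zero}  g = refl
  toℚ-∣tabulate∣ {ℕ.suc n} g with g zero
  ... | true  = cong (1ℚ +_) (toℚ-∣tabulate∣ (λ i → g (suc i)))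
  ... | false = trans (toℚ-∣tabulate∣ (λ i → g (suc i))) (sym (+-identityˡ _))

  toℚ-∣∣ : ∀ {n} (S : Subset n) → toℚ ∣ S ∣ ≡ sum (λ i → ⟦ lookup S i ⟧)
  toℚ-∣∣ S = trans (cong (λ p → toℚ ∣ p ∣) (sym (tabulate∘lookup S))) (toℚ-∣tabulate∣ (lookup S))

  sum-1≡toℚ : ∀ n → sum {n} (λ _ → 1ℚ) ≡ toℚ n
  sum-1≡toℚ ℕ.zero    = refl
  sum-1≡toℚ (ℕ.suc n) = cong (1ℚ +_) (sum-1≡toℚ n)

-- Powers of one half, and the weight as a sum over all vertices.

module Weight {n : ℕ} (G : Graph n) (S : Subset n) where

  open RationalSums
  open import Data.Bool using (true; false)
  open import Data.Fin using (Fin; zero; suc)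
  import Data.Nat as ℕ
  import Data.Nat.Properties as ℕ
  open import Data.Rational using (ℚ; ½; 0ℚ; 1ℚ; _+_; _*_; _≤_; nonNegative)
  open import Data.Rational.Properties
  open import Data.Vec using (_∷_; lookup)
  open import Relation.Binary.PropositionalEquality using (_≡_; refl; sym; trans; cong; cong₂; subst)

  halfPow-nonNeg : ∀ k → 0ℚ ≤ halfPow G S k
  halfPow-nonNeg ℕ.zero    = 0≤1
  halfPow-nonNeg (ℕ.suc k) = *-nonNeg (nonNegative⁻¹ ½) (halfPow-nonNeg k)

  halfPow-suc-≤ : ∀ k → halfPow G S (ℕ.suc k) ≤ halfPow G S k
  halfPow-suc-≤ k = subst (½ * halfPow G S k ≤_) (*-identityˡ _)
    (*-monoʳ-≤-nonNeg (halfPow G S k) {{nonNegative (halfPow-nonNeg k)}} (≤ᵇ⇒≤ {½} {1ℚ} _))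

  -- `≤′` grows at its upper end, so each of its steps is one application of `halfPow-suc-≤`.
  halfPow-anti-≤ : ∀ {j k} → j ℕ.≤′ k → halfPow G S k ≤ halfPow G S j
  halfPow-anti-≤ (ℕ.≤′-reflexive refl) = ≤-refl
  halfPow-anti-≤ (ℕ.≤′-step {k} j≤k)   = ≤-trans (halfPow-suc-≤ k) (halfPow-anti-≤ j≤k)

  mutual
    -- The local function `go` of `sumS` cannot be named from here.  In `sumS-cons-false` all the
    -- arguments of `go` become variables, so unification is forced to solve `partialSum` as `go`.
    partialSum : ∀ {n} → Graph n → Subset n → (Fin n → ℚ) → (m : ℕ) → (Fin m → Fin n) → ℚ
    partialSum = _

    sumS-cons-false : ∀ n (G : Graph (ℕ.suc n)) S f → sumS G (false ∷ S) f ≡ sumS G (false ∷ S) f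
    sumS-cons-false n G S f with ℕ.suc n | G | false ∷ S | f | Fin.suc {n}
    ... | _ | G' | S' | f' | ι = refl {x = partialSum G' S' f' n ι}

  -- Each recursive call composes `ι` with `suc`, so the induction needs an arbitrary `ι` in place
  -- of the identity.
  partialSum≡sum : ∀ (f : Fin n → ℚ) m (ι : Fin m → Fin n) →
    partialSum G S f m ι ≡ sum (λ i → f (ι i) * ⟦ lookup S (ι i) ⟧)
  partialSum≡sum f ℕ.zero    ι = refl
  partialSum≡sum f (ℕ.suc m) ι with lookup S (ι zero)
  ... | true  = cong₂ _+_ (sym (*-identityʳ (f (ι zero)))) (partialSum≡sum f m (λ i → ι (suc i)))
  ... | false = trans (partialSum≡sum f m (λ i → ι (suc i)))
                  (sym (trans (cong (_+ rest) (*-zeroʳ (f (ι zero)))) (+-identityˡ rest)))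
    where rest = sum (λ i → f (ι (suc i)) * ⟦ lookup S (ι (suc i)) ⟧)

  sumS≡sum : ∀ (f : Fin n → ℚ) → sumS G S f ≡ sum (λ v → f v * ⟦ lookup S v ⟧)
  sumS≡sum f = partialSum≡sum f n (λ i → i)

-- Paths, leaves, and the edge bound for acyclic graphs.

module Forests where

  open RationalSums
  open import Data.Bool using (true; false)
  import Data.Bool.Properties as Bool
  open import Data.Fin using (Fin; zero; suc; toℕ; inject₁; inject≤; fromℕ; punchIn; _≟_)
  open import Data.Fin.Properties
    using ( toℕ-injective; toℕ-inject≤; toℕ-inject₁; toℕ-fromℕ; toℕ<n; inject≤-injective
          ; suc-injective; any?; punchIn-injective; pigeonhole)
  import Data.Nat as ℕ
  import Data.Nat.Properties as ℕ
  open import Data.Product using (∃; _×_; _,_)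
  open import Data.Rational using (ℚ; 0ℚ; 1ℚ; _+_; _*_; _≤_)
  open import Data.Rational.Properties
    using (≤-refl; ≤-reflexive; ≤-trans; +-mono-≤; +-identityˡ; nonNegative⁻¹; module ≤-Reasoning)
  open import Data.Rational.Solver using (module +-*-Solver)
  open import Data.Sum using (_⊎_; inj₁; inj₂)
  open import Data.Vec using (Vec; []; _∷_; lookup; tabulate; map)
  open import Data.Vec.Properties using (lookup∘tabulate; lookup-map)
  open import Relation.Binary.PropositionalEquality
    using (_≡_; _≢_; refl; sym; trans; cong; cong₂; subst₂; module ≡-Reasoning)
  open import Relation.Nullary using (yes; no; does; ¬?)
  open import Relation.Nullary.Decidable using (_×-dec_)
  open import Relation.Nullary.Negation using (contradiction)
  open +-*-Solver using (solve; _:=_; _:+_; _:*_; con)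

  consPath : ∀ {n} (G : Graph n) {k x} {p : Vec (Fin n) (ℕ.suc k)} →
    adj G x (lookup p zero) ≡ true → (∀ i → lookup p i ≢ x) → IsPath G k p → IsPath G (ℕ.suc k) (x ∷ p)
  consPath G {k} {x} {p} x~p x∉p (edges , injective) = edges′ , injective′
    where
    edges′ : ∀ i → adj G (lookup (x ∷ p) (inject₁ i)) (lookup (x ∷ p) (suc i)) ≡ true
    edges′ zero    = x~p
    edges′ (suc i) = edges i
    injective′ : ∀ i j → lookup (x ∷ p) i ≡ lookup (x ∷ p) j → i ≡ j
    injective′ zero    zero    _  = refl
    injective′ zero    (suc j) eq = contradiction (sym eq) (x∉p j)
    injective′ (suc i) zero    eq = contradiction eq (x∉p i)
    injective′ (suc i) (suc j) eq = cong suc (injective i j eq)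

  tailPath : ∀ {n} (G : Graph n) {k x} {p : Vec (Fin n) (ℕ.suc k)} →
    IsPath G (ℕ.suc k) (x ∷ p) → IsPath G k p
  tailPath G (edges , injective) =
    (λ i → edges (suc i)) , (λ i j eq → suc-injective (injective (suc i) (suc j) eq))

  -- Cuts a path at the vertex where a chord from its start lands; prefix and chord together form a
  -- cycle.
  prefixPath : ∀ {n} (G : Graph n) {k} (p : Vec (Fin n) (ℕ.suc k)) → IsPath G k p →
    (i : Fin (ℕ.suc k)) → ∃ λ q → IsPath G (toℕ i) q × start G q ≡ lookup p zero × end G q ≡ lookup p i
  prefixPath {n} G {k} p (edges , injective) i = q , (edges′ , injective′) , lookup-q zero , end-q
    where
    i≤k : toℕ i ℕ.≤ k
    i≤k = ℕ.s≤s⁻¹ (toℕ<n i)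
    ι : Fin (ℕ.suc (toℕ i)) → Fin (ℕ.suc k)
    ι a = inject≤ a (ℕ.s≤s i≤k)
    q : Vec (Fin n) (ℕ.suc (toℕ i))
    q = tabulate (λ a → lookup p (ι a))
    lookup-q : ∀ a → lookup q a ≡ lookup p (ι a)
    lookup-q = lookup∘tabulate (λ a → lookup p (ι a))
    ι-inject₁ : ∀ a → inject₁ (inject≤ a i≤k) ≡ ι (inject₁ a)
    ι-inject₁ a = toℕ-injective (trans (toℕ-inject₁ _) (trans (toℕ-inject≤ a i≤k)
      (sym (trans (toℕ-inject≤ (inject₁ a) (ℕ.s≤s i≤k)) (toℕ-inject₁ a)))))
    edges′ : ∀ a → adj G (lookup q (inject₁ a)) (lookup q (suc a)) ≡ true
    edges′ a = subst₂ (λ x y → adj G x y ≡ true)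
      (sym (trans (lookup-q (inject₁ a)) (cong (lookup p) (sym (ι-inject₁ a)))))
      (sym (lookup-q (suc a)))
      (edges (inject≤ a i≤k))
    injective′ : ∀ a b → lookup q a ≡ lookup q b → a ≡ b
    injective′ a b eq = inject≤-injective (ℕ.s≤s i≤k) (ℕ.s≤s i≤k) a b
      (injective (ι a) (ι b) (trans (sym (lookup-q a)) (trans eq (lookup-q b))))
    end-q : end G q ≡ lookup p i
    end-q = trans (lookup-q (fromℕ (toℕ i))) (cong (lookup p)
      (toℕ-injective (trans (toℕ-inject≤ _ (ℕ.s≤s i≤k)) (toℕ-fromℕ (toℕ i)))))

  A : ∀ {n} → Graph n → Fin n → Fin n → ℚ
  A G u v = ⟦ adj G u v ⟧

  -- Isolated vertices count as leaves, so that leaf deletion runs over forests.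
  HasLeaf : ∀ {n} → Graph n → Set
  HasLeaf {n} G = ∃ λ (x : Fin n) → sum (A G x) ≤ 1ℚ

  -- If `z` is the only possible neighbour, the row of `x` in the adjacency matrix lies below the
  -- Kronecker delta at `z`, whose sum is 1.
  leaf-or-neighbour≢ : ∀ {n} (G : Graph n) x z → sum (A G x) ≤ 1ℚ ⊎ ∃ λ y → adj G x y ≡ true × y ≢ z
  leaf-or-neighbour≢ G x z with any? (λ y → (adj G x y Bool.≟ true) ×-dec ¬? (y ≟ z))
  ... | yes found = inj₂ found
  ... | no  none  = inj₁ (≤-trans (sum-mono-≤ A≤kronecker) (≤-reflexive (sum-kronecker z)))
    where
    A≤kronecker : ∀ y → A G x y ≤ ⟦ does (y ≟ z) ⟧
    A≤kronecker y with adj G x y in x~y | y ≟ z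
    ... | true  | yes _  = ≤-refl
    ... | true  | no y≢z = contradiction (y , x~y , y≢z) none
    ... | false | yes _  = 0≤1
    ... | false | no _   = ≤-refl

  -- The new vertex `y` differs from the start by irreflexivity and from the second vertex by
  -- hypothesis. If it occurred at an index of at least 2, the prefix ending there would have at
  -- least three vertices and be closed to a cycle by the edge to `y`. Phrasing the hypothesis with
  -- `toℕ i ≡ 1` makes it vacuous for one-vertex paths.
  extendPath : ∀ {n} (G : Graph n) → Acyclic G → ∀ {k} (p : Vec (Fin n) (ℕ.suc k)) → IsPath G k p →
    ∀ y → adj G (lookup p zero) y ≡ true → (∀ i → toℕ i ≡ 1 → y ≢ lookup p i) → IsPath G (ℕ.suc k) (y ∷ p)
  extendPath G acyclic p path y x~y y≢x₁ = consPath G (trans (Graph.sym G y _) x~y) y∉p path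
    where
    y∉p : ∀ i → lookup p i ≢ y
    y∉p zero refl = contradiction (trans (sym x~y) (Graph.irrefl G y)) λ ()
    y∉p (suc zero) eq = y≢x₁ (suc zero) refl (sym eq)
    y∉p i@(suc (suc j)) eq with prefixPath G p path i
    ... | q , q-path , start-q , end-q = acyclic (toℕ j) q q-path
      (subst₂ (λ a b → adj G a b ≡ true) (sym (trans end-q eq)) (sym start-q) (trans (Graph.sym G y _) x~y))

  -- The path grows at its front: the first vertex either is a leaf or has a neighbour other than
  -- the second vertex.
  leaf-or-path : ∀ {n} (G : Graph (ℕ.suc n)) → Acyclic G → ∀ k →
    HasLeaf G ⊎ ∃ λ p → IsPath G k p
  leaf-or-path G acyclic ℕ.zero = inj₂ (zero ∷ [] , (λ ()) , λ { zero zero _ → refl })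
  leaf-or-path G acyclic (ℕ.suc k) with leaf-or-path G acyclic k
  ... | inj₁ leaf = inj₁ leaf
  -- There is no second vertex to avoid yet, so `x` itself serves as a dummy.
  ... | inj₂ (x ∷ [] , path) with leaf-or-neighbour≢ G x x
  ...   | inj₁ leaf            = inj₁ (x , leaf)
  ...   | inj₂ (y , x~y , _)   = inj₂ (y ∷ x ∷ [] , extendPath G acyclic _ path y x~y λ { zero () })
  leaf-or-path G acyclic (ℕ.suc k) | inj₂ (x ∷ x₁ ∷ p , path) with leaf-or-neighbour≢ G x x₁
  ...   | inj₁ leaf            = inj₁ (x , leaf)
  ...   | inj₂ (y , x~y , y≢x₁) = inj₂ (y ∷ x ∷ x₁ ∷ p , extendPath G acyclic _ path y x~y
            λ { zero () ; (suc zero) _ → y≢x₁ ; (suc (suc _)) () })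

  -- A path with `suc n` edges would have one vertex more than the graph.
  acyclic⇒leaf : ∀ {n} (G : Graph (ℕ.suc n)) → Acyclic G → HasLeaf G
  acyclic⇒leaf {n} G acyclic with leaf-or-path G acyclic (ℕ.suc n)
  ... | inj₁ leaf = leaf
  ... | inj₂ (p , _ , injective) with pigeonhole (ℕ.n<1+n (ℕ.suc n)) (lookup p)
  ...   | i , j , i<j , eq = contradiction (cong toℕ (injective i j eq)) (ℕ.<⇒≢ i<j)

  deleteVertex : ∀ {n} → Graph (ℕ.suc n) → Fin (ℕ.suc n) → Graph n
  deleteVertex G x = record
    { adj    = λ u v → adj G (punchIn x u) (punchIn x v)
    ; sym    = λ u v → Graph.sym G (punchIn x u) (punchIn x v)
    ; irrefl = λ u → Graph.irrefl G (punchIn x u)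
    }

  deleteVertex-acyclic : ∀ {n} (G : Graph (ℕ.suc n)) x → Acyclic G → Acyclic (deleteVertex G x)
  deleteVertex-acyclic G x acyclic k p (edges , injective) closed =
    acyclic k (map (punchIn x) p) (edges′ , injective′)
      (subst₂ (λ u v → adj G u v ≡ true) (sym (lookup-map (fromℕ _) (punchIn x) p)) (sym (lookup-map zero (punchIn x) p)) closed)
    where
    edges′ : ∀ i → adj G (lookup (map (punchIn x) p) (inject₁ i)) (lookup (map (punchIn x) p) (suc i)) ≡ true
    edges′ i = subst₂ (λ u v → adj G u v ≡ true)
      (sym (lookup-map (inject₁ i) (punchIn x) p)) (sym (lookup-map (suc i) (punchIn x) p)) (edges i)
    injective′ : ∀ i j → lookup (map (punchIn x) p) i ≡ lookup (map (punchIn x) p) j → i ≡ j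
    injective′ i j eq = injective i j (punchIn-injective x _ _
      (trans (sym (lookup-map i (punchIn x) p)) (trans eq (lookup-map j (punchIn x) p))))

  degreeSum : ∀ {n} → Graph n → ℚ
  degreeSum G = sum (λ u → sum (A G u))

  -- Deletion removes one row and one column of the adjacency matrix. By symmetry and the zero
  -- diagonal, each of them contributes the degree of `x`.
  degreeSum-deleteVertex : ∀ {n} (G : Graph (ℕ.suc n)) x →
    degreeSum G ≡ 2ℚ * sum (A G x) + degreeSum (deleteVertex G x)
  degreeSum-deleteVertex G x = begin
    degreeSum G
      ≡⟨ sum-remove {i = x} (λ u → sum (A G u)) ⟩
    d + sum (λ u → sum (A G (punchIn x u)))
      ≡⟨ cong (d +_) (sum-cong-≗ (λ u → sum-remove {i = x} (A G (punchIn x u)))) ⟩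
    d + sum (λ u → A G (punchIn x u) x + sum (A G′ u))
      ≡⟨ cong (d +_) (∑-distrib-+ (λ u → A G (punchIn x u) x) (λ u → sum (A G′ u))) ⟩
    d + (sum (λ u → A G (punchIn x u) x) + degreeSum G′)
      ≡⟨ cong (λ y → d + (y + degreeSum G′)) column ⟩
    d + (d + degreeSum G′)
      ≡⟨ solve 2 (λ a b → a :+ (a :+ b) := con 2ℚ :* a :+ b) refl d (degreeSum G′) ⟩
    2ℚ * d + degreeSum G′ ∎
    where
    open ≡-Reasoning
    G′ = deleteVertex G x
    d = sum (A G x)
    column : sum (λ u → A G (punchIn x u) x) ≡ d
    column = sym (trans (sum-remove {i = x} (A G x)) (trans
      (cong₂ _+_ (cong ⟦_⟧ (Graph.irrefl G x)) (sum-cong-≗ (λ u → cong ⟦_⟧ (Graph.sym G x (punchIn x u)))))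
      (+-identityˡ _)))

  -- This is |E| ≤ order - 1, doubled: deleting a leaf lowers the degree sum by at most 2, and a
  -- single vertex has no edge.
  acyclic⇒degreeSum≤ : ∀ n (G : Graph (ℕ.suc n)) → Acyclic G → degreeSum G ≤ 2ℚ * toℚ n
  acyclic⇒degreeSum≤ ℕ.zero G acyclic =
    ≤-reflexive (cong (λ b → (⟦ b ⟧ + 0ℚ) + 0ℚ) (Graph.irrefl G zero))
  acyclic⇒degreeSum≤ (ℕ.suc n) G acyclic with acyclic⇒leaf G acyclic
  ... | x , leaf = begin
    degreeSum G
      ≡⟨ degreeSum-deleteVertex G x ⟩
    2ℚ * sum (A G x) + degreeSum (deleteVertex G x)
      ≤⟨ +-mono-≤ (*-monoˡ-≤ (nonNegative⁻¹ 2ℚ) leaf)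
           (acyclic⇒degreeSum≤ n (deleteVertex G x) (deleteVertex-acyclic G x acyclic)) ⟩
    2ℚ * 1ℚ + 2ℚ * toℚ n
      ≡⟨ solve 1 (λ a → con 2ℚ :* con 1ℚ :+ con 2ℚ :* a := con 2ℚ :* (con 1ℚ :+ a)) refl (toℚ n) ⟩
    2ℚ * toℚ (ℕ.suc n) ∎
    where open ≤-Reasoning

-- Paths from outside `S` to a vertex of `S`, and the weights they yield.

module Domination {n : ℕ} (G : Graph n) (S : Subset n) where

  open RationalSums
  open Weight G S
  open Forests
  open import Data.Bool using (true; false; not)
  open import Data.Fin using (Fin; zero; suc; toℕ; _≟_)
  open import Data.Fin.Properties using (any?; sequence)
  open import Data.Fin.Subset using (_∈_; _∉_)
  open import Data.Maybe using (Maybe; just; nothing)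
  import Data.Nat as ℕ
  import Data.Nat.Properties as ℕ
  open import Data.Nat.Induction using (<-rec)
  open import Data.Product using (∃; ∃₂; _×_; _,_; proj₁; proj₂)
  open import Data.Rational using (ℚ; 0ℚ; 1ℚ; ½; _+_; _*_; _-_; -_; _≤_)
  open import Data.Rational.Properties hiding (_≟_)
  open import Data.Rational.Solver using (module +-*-Solver)
  open import Data.Sum using (inj₁; inj₂)
  open import Data.Vec using (Vec; []; _∷_; lookup)
  open import Data.Vec.Properties using ([]=⇒lookup; lookup⇒[]=)
  open import Effect.Monad using (RawMonad)
  open import Relation.Binary.PropositionalEquality
    using (_≡_; _≢_; refl; sym; trans; cong; cong₂; subst; subst₂; module ≡-Reasoning)
  open import Relation.Nullary using (¬_; yes; no; does)
  open import Relation.Nullary.Negation using (contradiction; ¬¬-Monad)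
  open +-*-Solver using (solve; _:=_; _:+_; _:*_; _:-_; con)

  -- For a start outside `S` and `v` in `S` these are exactly the paths of `SPathBetween`, with the
  -- case distinction on the endvertices resolved. The start is left free and membership of `v` in
  -- `S` is kept apart, so tails and suffixes are again approaches.
  IsApproach : Fin n → (k : ℕ) → Vec (Fin n) (ℕ.suc k) → Set
  IsApproach v k p = IsPath G k p × end G p ≡ v × (∀ i → toℕ i ℕ.< k → lookup p i ∉ S)

  SPath⇒approach : ∀ {u v k} → u ∉ S → SPathBetween G S u v k →
    ∃ λ p → IsApproach v k p × start G p ≡ u
  SPath⇒approach {v = v} {k} u∉S (p , (path , _ , internal) , refl , end≡v) =
    p , (path , end≡v , avoids) , refl
    where
    avoids : ∀ i → toℕ i ℕ.< k → lookup p i ∉ S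
    avoids zero    _   = u∉S
    avoids (suc i) i<k = internal (suc i) (ℕ.s≤s ℕ.z≤n) i<k

  approach⇒SPath : ∀ {u v k} p → u ∉ S → v ∈ S → IsApproach v k p → start G p ≡ u →
    SPathBetween G S u v k
  approach⇒SPath p u∉S v∈S (path , refl , avoids) refl =
    p , (path , inj₂ (inj₁ (u∉S , v∈S)) , λ i _ → avoids i) , refl , refl

  tailApproach : ∀ {v k x p} → IsApproach v (ℕ.suc k) (x ∷ p) → IsApproach v k p
  tailApproach (path , end≡v , avoids) =
    tailPath G path , end≡v , λ i i<k → avoids (suc i) (ℕ.s≤s i<k)

  consApproach : ∀ {v k x p} → x ∉ S → adj G x (start G p) ≡ true → (∀ i → lookup p i ≢ x) →
    IsApproach v k p → IsApproach v (ℕ.suc k) (x ∷ p)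
  consApproach {k = k} {x} {p} x∉S x~p x∉p (path , end≡v , avoids) =
    consPath G x~p x∉p path , end≡v , avoids′
    where
    avoids′ : ∀ i → toℕ i ℕ.< ℕ.suc k → lookup (x ∷ p) i ∉ S
    avoids′ zero    _           = x∉S
    avoids′ (suc i) (ℕ.s≤s i<k) = avoids i i<k

  suffixApproach : ∀ {v k} (p : Vec (Fin n) (ℕ.suc k)) → IsApproach v k p → (i : Fin (ℕ.suc k)) →
    ∃₂ λ j q → j ℕ.≤ k × IsApproach v j q × start G q ≡ lookup p i
  suffixApproach p approach zero = _ , p , ℕ.≤-refl , approach , refl
  suffixApproach {k = ℕ.suc k} (x ∷ p) approach (suc i) with suffixApproach p (tailApproach {x = x} approach) i
  ... | j , q , j≤k , q-approach , eq = j , q , ℕ.m≤n⇒m≤1+n j≤k , q-approach , eq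

  -- Moving along an edge outside `S` increases the distance to `v` by at most one. Prepending `x`
  -- to an approach from `u` gives a path unless `x` already lies on it, and then the suffix from
  -- `x` is short enough.
  neighbour-SPath : ∀ {u v x k} → u ∉ S → v ∈ S → x ∉ S → adj G u x ≡ true →
    SPathBetween G S u v k → ∃ λ j → j ℕ.≤ ℕ.suc k × SPathBetween G S x v j
  neighbour-SPath {x = x} {k} u∉S v∈S x∉S u~x u⇝v with SPath⇒approach u∉S u⇝v
  ... | p , approach , refl with any? (λ i → lookup p i ≟ x)
  ...   | no x∉p = ℕ.suc k , ℕ.≤-refl , approach⇒SPath (x ∷ p) x∉S v∈S
            (consApproach {p = p} x∉S (trans (Graph.sym G x _) u~x) (λ i eq → x∉p (i , eq)) approach) refl
  ...   | yes (i , refl) with suffixApproach p approach i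
  ...     | j , q , j≤k , q-approach , eq =
              j , ℕ.m≤n⇒m≤1+n j≤k , approach⇒SPath q x∉S v∈S q-approach eq

  weightTerm-nonNeg : ∀ d → 0ℚ ≤ weightTerm G S d
  weightTerm-nonNeg nothing          = ≤-refl
  weightTerm-nonNeg (just ℕ.zero)    = nonNegative⁻¹ (1ℚ + 1ℚ)
  weightTerm-nonNeg (just (ℕ.suc k)) = halfPow-nonNeg k

  -- Any connecting path bounds the distance from above, and the weight decreases with the distance.
  -- The bound is `ℕ.suc k` because distance d has weight (1/2)^(d-1).
  halfPow≤weightTerm : ∀ {x v d j k} → IsDist G S x v d → SPathBetween G S x v j → j ℕ.≤ ℕ.suc k →
    halfPow G S k ≤ weightTerm G S d
  halfPow≤weightTerm {d = nothing} none x⇝v _ = contradiction x⇝v (none _)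
  -- Distance 0 has weight 2, above every `halfPow`, which is at most 1.
  halfPow≤weightTerm {d = just ℕ.zero} {k = k} _ _ _ =
    ≤-trans (halfPow-anti-≤ (ℕ.≤⇒≤′ (ℕ.z≤n {k}))) (+-monoʳ-≤ 1ℚ 0≤1)
  halfPow≤weightTerm {d = just (ℕ.suc d)} (_ , minimal) x⇝v j≤1+k =
    halfPow-anti-≤ (ℕ.≤⇒≤′ (ℕ.s≤s⁻¹ (ℕ.≤-trans (ℕ.≮⇒≥ λ j<d → minimal _ j<d x⇝v) j≤1+k)))

  -- Distances exist only up to double negation here; this suffices as the final inequality is
  -- decidable.
  ¬¬-dist : ∀ u v → ¬ ¬ ∃ (IsDist G S u v)
  ¬¬-dist u v none = none (nothing , <-rec _ λ k below u⇝v → none (just k , u⇝v , λ j → below {j}))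

  lookup≡true⇒∈ : ∀ {v} → lookup S v ≡ true → v ∈ S
  lookup≡true⇒∈ {v} = lookup⇒[]= v S

  not-lookup≡true⇒∉ : ∀ {v} → not (lookup S v) ≡ true → v ∉ S
  not-lookup≡true⇒∉ eq v∈S with trans (sym eq) (cong not ([]=⇒lookup v∈S))
  ... | ()

  ∉⇒lookup≡false : ∀ {v} → v ∉ S → lookup S v ≡ false
  ∉⇒lookup≡false {v} v∉S with lookup S v in eq
  ... | true  = contradiction (lookup≡true⇒∈ eq) v∉S
  ... | false = refl

  -- Degrees into `S` and into its complement.

  s t : Fin n → ℚ
  s v = ⟦ lookup S v ⟧
  t v = ⟦ not (lookup S v) ⟧

  degree-∉ degree-∈ capacity : Fin n → ℚ
  degree-∉ u = sum (λ x → A G u x * t x)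
  degree-∈ u = sum (λ x → A G u x * s x)
  capacity u = 3ℚ - degree-∉ u

  A-sym : ∀ u v → A G u v ≡ A G v u
  A-sym u v = cong ⟦_⟧ (Graph.sym G u v)

  -- The adjacency matrix is self-adjoint: a weighted count of edges may start from either end.
  ∑-A-swap : ∀ (a b : Fin n → ℚ) →
    sum (λ u → a u * sum (λ x → A G u x * b x)) ≡ sum (λ x → b x * sum (λ u → A G x u * a u))
  ∑-A-swap a b = trans (∑-bilinear a (A G) b)
    (sum-cong-≗ λ x → cong (b x *_) (sum-cong-≗ λ u → cong (_* a u) (A-sym u x)))

  degree-∈-nonNeg : ∀ u → 0ℚ ≤ degree-∈ u
  degree-∈-nonNeg u = sum-nonNeg λ x → *-nonNeg (⟦⟧-nonNeg (adj G u x)) (⟦⟧-nonNeg (lookup S x))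

  degree-split : ∀ u → sum (A G u) ≡ degree-∉ u + degree-∈ u
  degree-split u = trans
    (sum-cong-≗ λ x → trans (sym (*-identityʳ (A G u x)))
      (trans (cong (A G u x *_) (trans (sym (⟦⟧-complement (lookup S x))) (+-comm (s x) (t x))))
        (*-distribˡ-+ (A G u x) (t x) (s x))))
    (∑-distrib-+ (λ x → A G u x * t x) (λ x → A G u x * s x))

  -- The local inequality for the weights and its sum over the complement of `S`.

  module Weights (δ : Fin n → Fin n → Maybe ℕ) (isDist : ∀ u v → IsDist G S u v (δ u v)) where

    f : Fin n → Fin n → ℚ
    f u v = weightTerm G S (δ u v)

    nearby : Fin n → Fin n → ℚ
    nearby u v = sum (λ x → A G u x * (t x * f x v))

    module _ {u v} (u∉S : u ∉ S) (v∈S : v ∈ S) where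

      nearby-nonNeg : 0ℚ ≤ nearby u v
      nearby-nonNeg = sum-nonNeg λ x → *-nonNeg (⟦⟧-nonNeg (adj G u x))
        (*-nonNeg (⟦⟧-nonNeg (not (lookup S x))) (weightTerm-nonNeg (δ x v)))

      -- By `neighbour-SPath` a neighbour outside `S` is at most one step further from `v` than the
      -- given path says of `u`, which costs one factor `½`.
      neighbour-f : ∀ {k} → SPathBetween G S u v (ℕ.suc k) → ∀ x →
        A G u x * (t x * (½ * halfPow G S k)) ≤ A G u x * (t x * f x v)
      neighbour-f {k} u⇝v x = ⟦⟧-*-mono-≤ (adj G u x) λ u~x → ⟦⟧-*-mono-≤ (not (lookup S x)) λ x∉ →
        let j , j≤ , x⇝v = neighbour-SPath u∉S v∈S (not-lookup≡true⇒∉ x∉) u~x u⇝v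
        in halfPow≤weightTerm {k = ℕ.suc k} (isDist x v) x⇝v j≤

      sum-half : ∀ h → 2ℚ * sum (λ x → A G u x * (t x * (½ * h))) ≡ degree-∉ u * h
      sum-half h = begin
        2ℚ * sum (λ x → A G u x * (t x * (½ * h)))
          ≡⟨ cong (2ℚ *_) (sum-cong-≗ (λ x → sym (*-assoc (A G u x) (t x) (½ * h)))) ⟩
        2ℚ * sum (λ x → (A G u x * t x) * (½ * h))
          ≡⟨ cong (2ℚ *_) (sym (*-distribʳ-sum (½ * h) (λ x → A G u x * t x))) ⟩
        2ℚ * (degree-∉ u * (½ * h))
          ≡⟨ solve 2 (λ d y → con 2ℚ :* (d :* (con ½ :* y)) := d :* y) refl (degree-∉ u) h ⟩
        degree-∉ u * h ∎
        where open ≡-Reasoning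

      -- Write h for `halfPow G S (ℕ.suc k)` and d for `degree-∉ u`. The second vertex `y` of the
      -- path weighs at least 2h, and each of the other d - 1 neighbours outside `S` at least h/2;
      -- twice the total is 4h + (d - 1)h = (3 + d)h.
      neighbours-nonadjacent : ∀ {k} → SPathBetween G S u v (ℕ.suc (ℕ.suc k)) →
        (3ℚ + degree-∉ u) * halfPow G S (ℕ.suc k) ≤ 2ℚ * nearby u v
      neighbours-nonadjacent {k} u⇝v with SPath⇒approach u∉S u⇝v
      ... | _ ∷ y ∷ p , approach@(path , _ , avoids) , refl = begin
        (3ℚ + degree-∉ u) * h
          -- The factor `1ℚ` makes room for `sum at-y`, through which the surplus at `y` joins the
          -- sum over `x`.
          ≡⟨ solve 2 (λ d z → (con 3ℚ :+ d) :* z := d :* z :+ con 2ℚ :* (con 1ℚ :* (con (3ℚ * ½) :* z)))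
               refl (degree-∉ u) h ⟩
        degree-∉ u * h + 2ℚ * (1ℚ * extra)
          ≡⟨ cong₂ (λ a b → a + 2ℚ * (b * extra)) (sym (sum-half h)) (sym (sum-kronecker y)) ⟩
        2ℚ * sum lower + 2ℚ * (sum at-y * extra)
          ≡⟨ cong (λ a → 2ℚ * sum lower + 2ℚ * a) (*-distribʳ-sum extra at-y) ⟩
        2ℚ * sum lower + 2ℚ * sum (λ x → at-y x * extra)
          ≡⟨ sym (*-distribˡ-+ 2ℚ (sum lower) (sum (λ x → at-y x * extra))) ⟩
        2ℚ * (sum lower + sum (λ x → at-y x * extra))
          ≡⟨ cong (2ℚ *_) (sym (∑-distrib-+ lower (λ x → at-y x * extra))) ⟩
        2ℚ * sum (λ x → lower x + at-y x * extra)
          ≤⟨ *-monoˡ-≤ (nonNegative⁻¹ 2ℚ) (sum-mono-≤ pointwise) ⟩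
        2ℚ * nearby u v ∎
        where
        open ≤-Reasoning
        h = halfPow G S (ℕ.suc k)
        -- The surplus of 2h at `y` over the general lower bound h/2.
        extra = (3ℚ * ½) * h
        lower at-y : Fin n → ℚ
        lower x = A G u x * (t x * (½ * h))
        at-y x = ⟦ does (x ≟ y) ⟧
        y∉S : y ∉ S
        y∉S = avoids (suc zero) (ℕ.s≤s (ℕ.s≤s ℕ.z≤n))
        closer : halfPow G S k ≤ f y v
        closer = halfPow≤weightTerm (isDist y v)
          (approach⇒SPath (y ∷ p) y∉S v∈S (tailApproach {x = u} approach) refl) ℕ.≤-refl
        pointwise : ∀ x → lower x + at-y x * extra ≤ A G u x * (t x * f x v)
        pointwise x with x ≟ y
        ... | no _ = ≤-trans
          (≤-reflexive (trans (cong (lower x +_) (*-zeroˡ extra)) (+-identityʳ (lower x))))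
          (neighbour-f u⇝v x)
        -- At `y` both indicators are 1, and in units of `halfPow G S k` the left side is 1/4 + 3/4.
        ... | yes refl rewrite proj₁ path zero | ∉⇒lookup≡false y∉S = begin
          1ℚ * (1ℚ * (½ * (½ * halfPow G S k))) + 1ℚ * ((3ℚ * ½) * (½ * halfPow G S k))
            ≡⟨ solve 1 (λ z → con 1ℚ :* (con 1ℚ :* (con ½ :* (con ½ :* z))) :+ con 1ℚ :* ((con 3ℚ :* con ½) :* (con ½ :* z)) := z)
                 refl (halfPow G S k) ⟩
          halfPow G S k
            ≤⟨ closer ⟩
          f y v
            ≡⟨ solve 1 (λ z → z := con 1ℚ :* (con 1ℚ :* z)) refl (f y v) ⟩
          1ℚ * (1ℚ * f y v) ∎

      -- Some neighbour of u is twice as heavy if u is not adjacent to v, and every neighbour outside S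
      -- is at least half as heavy.
      local-inequality : (3ℚ + degree-∉ u) * f u v ≤ 2ℚ * nearby u v + 3ℚ * A G u v
      local-inequality with δ u v | isDist u v
      ... | nothing | _ = ≤-trans (≤-reflexive (*-zeroʳ (3ℚ + degree-∉ u)))
        (+-nonNeg (*-nonNeg (nonNegative⁻¹ 2ℚ) nearby-nonNeg) (*-nonNeg (nonNegative⁻¹ 3ℚ) (⟦⟧-nonNeg (adj G u v))))
      ... | just ℕ.zero | (_ ∷ [] , _ , refl , refl) , _ = contradiction v∈S u∉S
      -- The closer neighbour is now `v` itself, which lies in `S` and is not counted by `nearby`;
      -- the term with `A G u v` supplies the missing 3.
      ... | just (ℕ.suc ℕ.zero) | u⇝v@(_ ∷ _ ∷ [] , ((edges , _) , _) , refl , refl) , _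
        rewrite edges zero = begin
        (3ℚ + degree-∉ u) * 1ℚ
          ≡⟨ solve 1 (λ d → (con 3ℚ :+ d) :* con 1ℚ := d :* con 1ℚ :+ con 3ℚ :* con 1ℚ) refl (degree-∉ u) ⟩
        degree-∉ u * 1ℚ + 3ℚ * 1ℚ
          ≡⟨ cong (_+ 3ℚ * 1ℚ) (sym (sum-half 1ℚ)) ⟩
        2ℚ * sum (λ x → A G u x * (t x * (½ * 1ℚ))) + 3ℚ * 1ℚ
          ≤⟨ +-monoˡ-≤ (3ℚ * 1ℚ) (*-monoˡ-≤ (nonNegative⁻¹ 2ℚ) (sum-mono-≤ (neighbour-f u⇝v))) ⟩
        2ℚ * nearby u v + 3ℚ * 1ℚ ∎
        where open ≤-Reasoning
      ... | just (ℕ.suc (ℕ.suc k)) | u⇝v , _ = ≤-trans (neighbours-nonadjacent u⇝v)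
        (≤-trans (≤-reflexive (sym (+-identityʳ (2ℚ * nearby u v))))
          (+-monoʳ-≤ (2ℚ * nearby u v) (*-nonNeg (nonNegative⁻¹ 3ℚ) (⟦⟧-nonNeg (adj G u v)))))

    -- Sum the local inequality over u ∉ S: by symmetry of adjacency the neighbour sums turn into
    -- Σ t d f, which is absorbed on the left because 3 + d = (3 - d) + 2 d.
    spread-≤ : ∀ {v} → v ∈ S → sum (λ u → f u v * (t u * capacity u)) ≤ 3ℚ * degree-∉ v
    spread-≤ {v} v∈S = 0≤-⇒≤
      (solve 3 (λ c d q → con 3ℚ :* d :- c := (con 2ℚ :* q :+ con 3ℚ :* d) :- (con 1ℚ :* c :+ con 2ℚ :* q))
         refl spread (degree-∉ v) q)
      (≤⇒0≤- (subst₂ _≤_ lhs rhs (sum-mono-≤ λ u →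
         ⟦⟧-*-mono-≤ (not (lookup S u)) λ u∉ → local-inequality (not-lookup≡true⇒∉ u∉) v∈S)))
      where
      open ≡-Reasoning
      spread = sum (λ u → f u v * (t u * capacity u))
      q = sum (λ u → (t u * f u v) * degree-∉ u)
      lhs : sum (λ u → t u * ((3ℚ + degree-∉ u) * f u v)) ≡ 1ℚ * spread + 2ℚ * q
      lhs = trans
        (sum-cong-≗ λ u → solve 3 (λ τ d φ → τ :* ((con 3ℚ :+ d) :* φ) :=
           con 1ℚ :* (φ :* (τ :* (con 3ℚ :- d))) :+ con 2ℚ :* ((τ :* φ) :* d)) refl (t u) (degree-∉ u) (f u v))
        (∑-linear 1ℚ 2ℚ (λ u → f u v * (t u * capacity u)) (λ u → (t u * f u v) * degree-∉ u))
      rhs : sum (λ u → t u * (2ℚ * nearby u v + 3ℚ * A G u v)) ≡ 2ℚ * q + 3ℚ * degree-∉ v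
      rhs = begin
        sum (λ u → t u * (2ℚ * nearby u v + 3ℚ * A G u v))
          ≡⟨ sum-cong-≗ (λ u → trans
               (solve 3 (λ τ y a → τ :* (con 2ℚ :* y :+ con 3ℚ :* a) := con 2ℚ :* (τ :* y) :+ con 3ℚ :* (a :* τ))
                  refl (t u) (nearby u v) (A G u v))
               (cong (λ a → 2ℚ * (t u * nearby u v) + 3ℚ * (a * t u)) (A-sym u v))) ⟩
        sum (λ u → 2ℚ * (t u * nearby u v) + 3ℚ * (A G v u * t u))
          ≡⟨ ∑-linear 2ℚ 3ℚ (λ u → t u * nearby u v) (λ u → A G v u * t u) ⟩
        2ℚ * sum (λ u → t u * nearby u v) + 3ℚ * degree-∉ v
          ≡⟨ cong (λ y → 2ℚ * y + 3ℚ * degree-∉ v) (∑-A-swap t (λ x → t x * f x v)) ⟩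
        2ℚ * q + 3ℚ * degree-∉ v ∎

  -- inner-∉ and inner-∈ count every edge twice, cut counts every edge once.
  cut inner-∉ inner-∈ : ℚ
  cut     = sum (λ u → s u * degree-∉ u)
  inner-∉ = sum (λ u → t u * degree-∉ u)
  inner-∈ = sum (λ u → s u * degree-∈ u)

  inner-∈-nonNeg : 0ℚ ≤ inner-∈
  inner-∈-nonNeg = sum-nonNeg λ u → *-nonNeg (⟦⟧-nonNeg (lookup S u)) (degree-∈-nonNeg u)

  sum-s+sum-t : sum s + sum t ≡ toℚ n
  sum-s+sum-t = trans (sym (∑-distrib-+ s t))
    (trans (sum-cong-≗ (λ v → ⟦⟧-complement (lookup S v))) (sum-1≡toℚ n))

  -- Edges between `S` and its complement, counted from the other side.
  sum-t*degree-∈ : sum (λ u → t u * degree-∈ u) ≡ cut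
  sum-t*degree-∈ = ∑-A-swap t s

  sum-s*degree : sum (λ u → s u * sum (A G u)) ≡ 1ℚ * cut + 1ℚ * inner-∈
  sum-s*degree = trans (sum-cong-≗ (λ u → trans (cong (s u *_) (degree-split u))
      (solve 3 (λ a b c → a :* (b :+ c) := con 1ℚ :* (a :* b) :+ con 1ℚ :* (a :* c)) refl (s u) (degree-∉ u) (degree-∈ u))))
    (∑-linear 1ℚ 1ℚ (λ u → s u * degree-∉ u) (λ u → s u * degree-∈ u))

  sum-t*degree : sum (λ u → t u * sum (A G u)) ≡ 1ℚ * inner-∉ + 1ℚ * cut
  sum-t*degree = trans (sum-cong-≗ (λ u → trans (cong (t u *_) (degree-split u))
      (solve 3 (λ a b c → a :* (b :+ c) := con 1ℚ :* (a :* b) :+ con 1ℚ :* (a :* c)) refl (t u) (degree-∉ u) (degree-∈ u))))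
    (trans (∑-linear 1ℚ 1ℚ (λ u → t u * degree-∉ u) (λ u → t u * degree-∈ u))
      (cong (λ y → 1ℚ * inner-∉ + 1ℚ * y) sum-t*degree-∈))

  -- `cut` occurs twice because such an edge is counted at its end in `S` and at its end outside.
  degreeSum-split : degreeSum G ≡ (1ℚ * cut + 1ℚ * inner-∈) + (1ℚ * inner-∉ + 1ℚ * cut)
  degreeSum-split = trans
    (sum-cong-≗ λ u → trans (sym (*-identityˡ (sum (A G u))))
      (trans (cong (_* sum (A G u)) (sym (⟦⟧-complement (lookup S u)))) (*-distribʳ-+ (sum (A G u)) (s u) (t u))))
    (trans (∑-distrib-+ (λ u → s u * sum (A G u)) (λ u → t u * sum (A G u)))
      (cong₂ _+_ sum-s*degree sum-t*degree))

  -- Consequences of the degree bound 3.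

  module _ (deg≤3 : MaxDegreeAtMost G 3) where

    sum-A≤3 : ∀ u → sum (A G u) ≤ 3ℚ
    sum-A≤3 u = subst (_≤ 3ℚ) (toℚ-∣tabulate∣ (adj G u)) (toℚ-mono-≤ (deg≤3 u))

    -- This sign allows w(u) ≥ 1 to be multiplied by the capacity of `u`.
    capacity-nonNeg : ∀ u → 0ℚ ≤ capacity u
    capacity-nonNeg u = ≤⇒0≤- (≤-trans
      (subst₂ _≤_ (+-identityʳ (degree-∉ u)) (sym (degree-split u)) (+-monoʳ-≤ (degree-∉ u) (degree-∈-nonNeg u)))
      (sum-A≤3 u))

    cut+inner-∈-≤ : 1ℚ * cut + 1ℚ * inner-∈ ≤ sum s * 3ℚ
    cut+inner-∈-≤ = subst₂ _≤_ sum-s*degree (sym (*-distribʳ-sum 3ℚ s))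
      (sum-mono-≤ λ u → *-monoˡ-≤ (⟦⟧-nonNeg (lookup S u)) (sum-A≤3 u))

    -- The left side is the total capacity outside `S`. Weighting w(u) ≥ 1 by capacities and
    -- exchanging the sums leaves, for each `v` in `S`, the quantity bounded by `spread-≤`.
    capacity≤cut : IsExpDominating G S → (∀ u v → ∃ (IsDist G S u v)) → 3ℚ * sum t - inner-∉ ≤ 3ℚ * cut
    capacity≤cut dominating dist = begin
      3ℚ * sum t - inner-∉
        ≡⟨ solve 2 (λ a b → con 3ℚ :* a :- b := con 3ℚ :* a :+ con (- 1ℚ) :* b) refl (sum t) inner-∉ ⟩
      3ℚ * sum t + (- 1ℚ) * inner-∉
        ≡⟨ sym (∑-linear 3ℚ (- 1ℚ) t (λ u → t u * degree-∉ u)) ⟩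
      sum (λ u → 3ℚ * t u + (- 1ℚ) * (t u * degree-∉ u))
        ≡⟨ sum-cong-≗ (λ u → solve 2 (λ τ d → con 3ℚ :* τ :+ con (- 1ℚ) :* (τ :* d) := τ :* ((con 3ℚ :- d) :* con 1ℚ))
             refl (t u) (degree-∉ u)) ⟩
      sum (λ u → t u * (capacity u * 1ℚ))
        ≤⟨ sum-mono-≤ (λ u → *-monoˡ-≤ (⟦⟧-nonNeg (not (lookup S u))) (*-monoˡ-≤ (capacity-nonNeg u) (1≤w u))) ⟩
      sum (λ u → t u * (capacity u * sum (λ v → f u v * s v)))
        ≡⟨ sum-cong-≗ (λ u → sym (*-assoc (t u) (capacity u) (sum (λ v → f u v * s v)))) ⟩
      sum (λ u → (t u * capacity u) * sum (λ v → f u v * s v))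
        ≡⟨ ∑-bilinear (λ u → t u * capacity u) f s ⟩
      sum (λ v → s v * sum (λ u → f u v * (t u * capacity u)))
        ≤⟨ sum-mono-≤ (λ v → ⟦⟧-*-mono-≤ (lookup S v) λ v∈ → spread-≤ (lookup≡true⇒∈ v∈)) ⟩
      sum (λ v → s v * (3ℚ * degree-∉ v))
        ≡⟨ sum-cong-≗ (λ v → solve 2 (λ a b → a :* (con 3ℚ :* b) := con 3ℚ :* (a :* b)) refl (s v) (degree-∉ v)) ⟩
      sum (λ v → 3ℚ * (s v * degree-∉ v))
        ≡⟨ sym (*-distribˡ-sum 3ℚ (λ v → s v * degree-∉ v)) ⟩
      3ℚ * cut ∎
      where
      open ≤-Reasoning
      open Weights (λ u v → proj₁ (dist u v)) (λ u v → proj₂ (dist u v))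
      1≤w : ∀ u → 1ℚ ≤ sum (λ v → f u v * s v)
      1≤w u = subst (1ℚ ≤_) (sumS≡sum (f u))
        (dominating u (λ v → proj₁ (dist u v)) (λ v _ → proj₂ (dist u v)))

  -- Double negation commutes with quantification over a finite type, here applied once for each
  -- vertex variable.
  ¬¬-dists : ¬ ¬ (∀ u v → ∃ (IsDist G S u v))
  ¬¬-dists = sequence ¬¬-applicative λ u → sequence ¬¬-applicative λ v → ¬¬-dist u v
    where ¬¬-applicative = RawMonad.rawApplicative ¬¬-Monad

-- Linear combination of the inequalities.

module Counting where

  open RationalSums
  open Forests
  open import Data.Nat using (suc)
  import Data.Nat as ℕ
  open import Data.Product using (∃)
  open import Data.Rational using (1ℚ; _+_; _*_; _-_; _≤_)
  open import Data.Rational.Properties using (nonNegative⁻¹)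
  open import Data.Rational.Solver using (module +-*-Solver)
  open import Relation.Binary.PropositionalEquality using (refl; sym; trans; cong; subst; subst₂)
  open +-*-Solver using (solve; _:=_; _:+_; _:*_; _:-_; con)

  order-bound : ∀ n (G : Graph (suc n)) (S : Subset (suc n)) → Acyclic G → MaxDegreeAtMost G 3 →
    IsExpDominating G S → (∀ u v → ∃ (IsDist G S u v)) → suc n ℕ.+ 2 ℕ.≤ 6 ℕ.* ∣ S ∣
  order-bound n G S acyclic deg≤3 dominating dist = toℚ-cancel-≤
    (subst₂ _≤_ (sym (toℚ-+ (suc n) 2)) (sym (trans (toℚ-6* ∣ S ∣) (cong (6ℚ *_) (toℚ-∣∣ S)))) main)
    where
    open Domination G S
    h₁ : 3ℚ * sum t - inner-∉ ≤ 3ℚ * cut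
    h₁ = capacity≤cut deg≤3 dominating dist
    h₂ : (1ℚ * cut + 1ℚ * inner-∈) + (1ℚ * inner-∉ + 1ℚ * cut) ≤ 2ℚ * toℚ n
    h₂ = subst (_≤ 2ℚ * toℚ n) degreeSum-split (acyclic⇒degreeSum≤ n G acyclic)
    main : toℚ (suc n) + 2ℚ ≤ 6ℚ * sum s
    main = 0≤-⇒≤
      (trans
        (cong (λ y → 6ℚ * sum s - (y + 2ℚ)) (sym sum-s+sum-t))
        (trans
          -- The difference is the sum of the slacks of `h₁`, `h₂` and `cut+inner-∈-≤`, each with
          -- coefficient 1, plus 2 `inner-∈`. In `h₂` the number `n` appears as
          -- `(a :+ b) :- con 1ℚ`, since the order is `suc n`.
          (solve 5 (λ a b c x y → con 6ℚ :* a :- ((a :+ b) :+ con 2ℚ) :=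
              ((con 3ℚ :* c :- (con 3ℚ :* b :- x))
               :+ (con 2ℚ :* ((a :+ b) :- con 1ℚ) :- ((con 1ℚ :* c :+ con 1ℚ :* y) :+ (con 1ℚ :* x :+ con 1ℚ :* c))))
              :+ ((a :* con 3ℚ :- (con 1ℚ :* c :+ con 1ℚ :* y)) :+ con 2ℚ :* y))
            refl (sum s) (sum t) cut inner-∉ inner-∈)
          (cong (λ z → ((3ℚ * cut - (3ℚ * sum t - inner-∉)) + (2ℚ * z - ((1ℚ * cut + 1ℚ * inner-∈) + (1ℚ * inner-∉ + 1ℚ * cut))))
                       + ((sum s * 3ℚ - (1ℚ * cut + 1ℚ * inner-∈)) + 2ℚ * inner-∈))
            (trans (cong (_- 1ℚ) sum-s+sum-t) (solve 1 (λ z → (con 1ℚ :+ z) :- con 1ℚ := z) refl (toℚ n))))))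
      (+-nonNeg (+-nonNeg (≤⇒0≤- h₁) (≤⇒0≤- h₂))
        (+-nonNeg (≤⇒0≤- (cut+inner-∈-≤ deg≤3)) (*-nonNeg (nonNegative⁻¹ 2ℚ) inner-∈-nonNeg)))

-- Removal of the double negation, by decidability of `≤` on ℕ.

open import Data.Nat using (suc; _+_; _*_; _≤_; s≤s; _≤?_)
open import Data.Product using (_,_)
open import Relation.Nullary.Decidable using (decidable-stable)
open import Relation.Nullary.Negation using (¬¬-map)

theorem3 : ∀ (n : ℕ) (T : Graph n) → IsTree T → MaxDegreeAtMost T 3 →
    ∀ (S : Subset n) → IsExpDominating T S → n + 2 ≤ 6 * ∣ S ∣
theorem3 (suc n) T (s≤s _ , _ , acyclic) deg≤3 S dominating =
  decidable-stable (suc n + 2 ≤? 6 * ∣ S ∣)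
    (¬¬-map (Counting.order-bound n T S acyclic deg≤3 dominating) (Domination.¬¬-dists T S))
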